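{- Let $k,l$ be positive integers and $m\ge 0$ an integer. Let $N$ be a loopless and coloopless matroid of rank $k+m$ on a ground set of cardinality $k+l+m$. Then the matroid $\tau^m(N\oplus U_{k+m,k+l+m})$ (where $U_{k+m,k+l+m}$ is on a ground set disjoint from that of $N$) is a loopless and coloopless excluded minor for the class of almost $(k,l)$-uniform matroids.
   Context: For a matroid $M$ of positive rank, its truncation $\tau(M)$ is the matroid on the same ground set whose independent sets are the independent sets of $M$ that are not bases of $M$; $\tau^m$ denotes $m$-fold iterated truncation ($\tau^0$ is the identity). $U_{r,n}$ denotes the uniform matroid of rank $r$ on $n$ elements. A matroid is $(k,l)$-uniform if it has no minor isomorphic to $U_{k,k}\oplus U_{0,l}$. A matroid $M$ is almost $(k,l)$-uniform if for every element $v$, at least one of $M-v$ or $M/v$ is $(k,l)$-uniform. An excluded minor for a class is a matroid not in the class all of whose proper minors are in the class. -}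

module Defs where

open import Data.Nat using (ℕ; zero; suc; _+_; _≤ᵇ_; _<_)
open import Data.Bool using (Bool; true; false; _∧_; _∨_; not; if_then_else_; T)
open import Data.Fin using (Fin; zero; suc)
open import Data.Fin.Subset using (Subset; _∈_; _∉_; _⊆_; _∪_; ⁅_⁆; ∣_∣; ⊥; ⊤)
open import Data.Vec using (Vec; []; _∷_; lookup; take; drop; insertAt)
open import Data.Product using (Σ; ∃; _×_; _,_)
open import Data.Sum using (_⊎_)
open import Relation.Nullary using (¬_)
open import Relation.Binary.PropositionalEquality using (_≡_)
open import Function.Definitions using (Injective)

-- A (candidate) matroid on ground set Fin n, given by its independence
-- predicate (decidable, Bool-valued, as the ground set is finite).
IndepFn : ℕ → Set
IndepFn n = Subset n → Bool

Indep : ∀ {n} → IndepFn n → Subset n → Set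
Indep M X = T (M X)

record IsMatroid {n : ℕ} (M : IndepFn n) : Set where
  field
    empty-indep : Indep M ⊥
    hereditary  : ∀ X Y → Y ⊆ X → Indep M X → Indep M Y
    augment     : ∀ X Y → Indep M X → Indep M Y → ∣ X ∣ < ∣ Y ∣ →
                  ∃ λ y → y ∈ Y × y ∉ X × Indep M (X ∪ ⁅ y ⁆)

allᵇ : ∀ {n} → (Fin n → Bool) → Bool
allᵇ {zero}  f = true
allᵇ {suc n} f = f zero ∧ allᵇ (λ i → f (suc i))

isBaseᵇ : ∀ {n} → IndepFn n → Subset n → Bool
isBaseᵇ M X = M X ∧ allᵇ (λ y → lookup X y ∨ not (M (X ∪ ⁅ y ⁆)))

IsBase : ∀ {n} → IndepFn n → Subset n → Set
IsBase M X = Indep M X × (∀ y → y ∉ X → ¬ Indep M (X ∪ ⁅ y ⁆))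

HasRank : ∀ {n} → IndepFn n → ℕ → Set
HasRank M r = ∃ λ B → IsBase M B × ∣ B ∣ ≡ r

Loopless : ∀ {n} → IndepFn n → Set
Loopless M = ∀ e → Indep M ⁅ e ⁆

Coloopless : ∀ {n} → IndepFn n → Set
Coloopless M = ∀ e → ∃ λ B → IsBase M B × e ∉ B

U : (r n : ℕ) → IndepFn n
U r n X = ∣ X ∣ ≤ᵇ r

_⊕_ : ∀ {a b} → IndepFn a → IndepFn b → IndepFn (a + b)
_⊕_ {a} M N X = M (take a X) ∧ N (drop a X)

τ : ∀ {n} → IndepFn n → IndepFn n
τ M X = M X ∧ not (isBaseᵇ M X)

τ^ : ℕ → ∀ {n} → IndepFn n → IndepFn n
τ^ zero    M = M
τ^ (suc m) M = τ (τ^ m M)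

_del_ : ∀ {n} → IndepFn (suc n) → Fin (suc n) → IndepFn n
(M del v) X = M (insertAt X v false)

_con_ : ∀ {n} → IndepFn (suc n) → Fin (suc n) → IndepFn n
(M con v) X = if M ⁅ v ⁆ then M (insertAt X v true) else M (insertAt X v false)

image : ∀ {a b} → (Fin a → Fin b) → Subset a → Subset b
image f []      = ⊥
image f (x ∷ X) = (if x then ⁅ f zero ⁆ else ⊥) ∪ image (λ i → f (suc i)) X

-- N is isomorphic to a minor of M: N ≅ (M / C) \ D where C is the
-- contracted set, B a basis of M|C, and the remaining (undeleted)
-- elements are the image of the injection f.
HasMinor : ∀ {n n'} → IndepFn n → IndepFn n' → Set
HasMinor {n} {n'} M N =
  Σ (Fin n' → Fin n) λ f → Injective _≡_ _≡_ f ×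
  Σ (Subset n) λ C → (∀ i → f i ∉ C) ×
  Σ (Subset n) λ B → B ⊆ C × Indep M B ×
    (∀ y → y ∈ C → y ∉ B → ¬ Indep M (B ∪ ⁅ y ⁆)) ×
    (∀ X → N X ≡ M (image f X ∪ B))

ProperMinor : ∀ {n n'} → IndepFn n → IndepFn n' → Set
ProperMinor {n} {n'} M N = n' < n × HasMinor M N

KLUniform : ℕ → ℕ → ∀ {n} → IndepFn n → Set
KLUniform k l M = ¬ HasMinor M (U k k ⊕ U 0 l)

AlmostKLUniform : ℕ → ℕ → ∀ {n} → IndepFn n → Set
AlmostKLUniform k l {zero}  M = ⊤'
  where open import Data.Unit using () renaming (⊤ to ⊤')
AlmostKLUniform k l {suc n} M =
  ∀ v → KLUniform k l (M del v) ⊎ KLUniform k l (M con v)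

ExcludedMinorAlmostKLUniform : ℕ → ℕ → ∀ {n} → IndepFn n → Set
ExcludedMinorAlmostKLUniform k l M =
  ¬ AlmostKLUniform k l M ×
  (∀ {n'} (N : IndepFn n') → ProperMinor M N → AlmostKLUniform k l N)

{-# OPTIONS --safe #-}
module Submission where

-- Put r = k + m and let E₁, E₂ be the ground sets of N and of the uniform matroid. A set is
-- independent in M iff its parts are independent and its size is at most r + k. A minor
-- Uₖₖ ⊕ U₀ₗ of M, read off over an independent set B with loops L, gives a set S = B ∪ L of
-- corank ≥ k and nullity ≥ l, and the only such sets are E₁ and E₂: coloops of N are absent,
-- so dropping any point from E₁ lowers its nullity below l, and likewise for E₂.
-- In M itself both E₁ and E₂ are present, and every element v lies in exactly one of them, so
-- neither M − v nor M / v is (k,l)-uniform. In a proper minor M′, non-uniformity of M′ − v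
-- requires the side missing v and that of M′ / v the side containing v; a point of M outside
-- M′ rules out one of the two sides (the one containing it if it is deleted, the other one if
-- it is contracted). If v is a loop of M′, the side missing v could be enlarged by v, so
-- M′ − v is uniform.

open import Defs
open import Data.Nat using (ℕ; zero; suc; _+_; _∸_; _≤_; _<_; z≤n; s≤s; s≤s⁻¹)
open import Data.Nat.Properties hiding (suc-injective; 0≢1+n)
open import Data.Bool using (Bool; true; false; _∧_; _∨_; not; if_then_else_; T; T?)
open import Data.Bool.Properties using (T-≡; T-∧; T-∨; ¬-not)
  renaming (_≟_ to _≟ᵇ_)
open import Data.Fin using (Fin; zero; suc; _↑ˡ_; _↑ʳ_; punchIn; splitAt)
  renaming (_≟_ to _≟ᶠ_)
open import Data.Fin.Properties using (suc-injective; 0≢1+n; ↑ʳ-injective;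
  punchIn-injective; punchInᵢ≢i; splitAt-↑ˡ; splitAt-↑ʳ; any?; all?; ¬∀⟶∃¬; injective⇒≤)
open import Data.Fin.Subset using (Subset; _∈_; _∉_; _⊆_; _∪_; ⁅_⁆; ∣_∣; ⊥; ⊤; ∁; Nonempty)
open import Data.Fin.Subset.Properties
open import Data.Vec using ([]; _∷_; lookup; take; drop; insertAt; _++_; here; there)
open import Data.Vec.Properties using (take++drop≡id; zipWith-++;
  ++-injectiveˡ; ++-injectiveʳ; []=⇒lookup; lookup⇒[]=; lookup-++ˡ; lookup-++ʳ)
open import Data.Product using (∃; _×_; _,_; proj₁; proj₂)
open import Data.Sum using (_⊎_; inj₁; inj₂; [_,_]′)
open import Data.Empty using (⊥-elim)
open import Data.Unit using (tt)
open import Function using (_∘_; const)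
open import Function.Bundles using (Equivalence; _⇔_; mk⇔)
open import Function.Definitions using (Injective)
open import Relation.Nullary using (¬_; yes; no; contradiction)
open import Relation.Binary.PropositionalEquality using (_≡_; _≢_; refl; sym; trans; cong; cong₂; subst; module ≡-Reasoning)

open Equivalence using (to; from)

-- Subsets of finite sets

∣p∪q∣≡∣p∣+∣q∣ : ∀ {n} (p q : Subset n) → (∀ {x} → x ∈ p → x ∉ q) → ∣ p ∪ q ∣ ≡ ∣ p ∣ + ∣ q ∣
∣p∪q∣≡∣p∣+∣q∣ []          []          _    = refl
∣p∪q∣≡∣p∣+∣q∣ (true  ∷ p) (true  ∷ q) disj = contradiction here (disj here)
∣p∪q∣≡∣p∣+∣q∣ (true  ∷ p) (false ∷ q) disj =
  cong suc (∣p∪q∣≡∣p∣+∣q∣ p q λ x∈p x∈q → disj (there x∈p) (there x∈q))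
∣p∪q∣≡∣p∣+∣q∣ (false ∷ p) (true  ∷ q) disj =
  trans (cong suc (∣p∪q∣≡∣p∣+∣q∣ p q λ x∈p x∈q → disj (there x∈p) (there x∈q)))
        (sym (+-suc ∣ p ∣ ∣ q ∣))
∣p∪q∣≡∣p∣+∣q∣ (false ∷ p) (false ∷ q) disj =
  ∣p∪q∣≡∣p∣+∣q∣ p q λ x∈p x∈q → disj (there x∈p) (there x∈q)

x∉p⇒∣p∪⁅x⁆∣≡1+∣p∣ : ∀ {n} (p : Subset n) x → x ∉ p → ∣ p ∪ ⁅ x ⁆ ∣ ≡ suc ∣ p ∣
x∉p⇒∣p∪⁅x⁆∣≡1+∣p∣ p x x∉p = begin
  ∣ p ∪ ⁅ x ⁆ ∣      ≡⟨ ∣p∪q∣≡∣p∣+∣q∣ p ⁅ x ⁆ (λ y∈p y∈x → x∉p (subst (_∈ p) (x∈⁅y⁆⇒x≡y x y∈x) y∈p)) ⟩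
  ∣ p ∣ + ∣ ⁅ x ⁆ ∣  ≡⟨ cong (∣ p ∣ +_) (∣⁅x⁆∣≡1 x) ⟩
  ∣ p ∣ + 1          ≡⟨ +-comm ∣ p ∣ 1 ⟩
  suc ∣ p ∣          ∎
  where open ≡-Reasoning

∪-lub : ∀ {n} {p q s : Subset n} → p ⊆ s → q ⊆ s → p ∪ q ⊆ s
∪-lub {p = p} {q} p⊆s q⊆s x∈ = [ p⊆s , q⊆s ]′ (x∈p∪q⁻ p q x∈)

x∈p⇒⁅x⁆⊆p : ∀ {n} {p : Subset n} {x} → x ∈ p → ⁅ x ⁆ ⊆ p
x∈p⇒⁅x⁆⊆p {p = p} {x} x∈p y∈ = subst (_∈ p) (sym (x∈⁅y⁆⇒x≡y x y∈)) x∈p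

p∪⁅x⁆⊆ : ∀ {n} {p s : Subset n} {x} → p ⊆ s → x ∈ s → p ∪ ⁅ x ⁆ ⊆ s
p∪⁅x⁆⊆ p⊆s x∈s = ∪-lub p⊆s (x∈p⇒⁅x⁆⊆p x∈s)

x∈p∪⁅x⁆ : ∀ {n} (p : Subset n) x → x ∈ p ∪ ⁅ x ⁆
x∈p∪⁅x⁆ p x = q⊆p∪q p ⁅ x ⁆ (x∈⁅x⁆ x)

∣p∣<n⇒∃∉ : ∀ {n} (p : Subset n) → ∣ p ∣ < n → ∃ λ x → x ∉ p
∣p∣<n⇒∃∉ (true  ∷ p) (s≤s lt) with x , x∉p ← ∣p∣<n⇒∃∉ p lt = suc x , λ { (there x∈p) → x∉p x∈p }
∣p∣<n⇒∃∉ (false ∷ p) _        = zero , λ ()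

subset-of-size : ∀ {n} (p : Subset n) k → k ≤ ∣ p ∣ → ∃ λ q → q ⊆ p × ∣ q ∣ ≡ k
subset-of-size {n} p   zero    _   = ⊥ , ⊥⊆ , ∣⊥∣≡0 n
subset-of-size (true  ∷ p) (suc k) k≤p with q , q⊆p , ∣q∣≡k ← subset-of-size p k (s≤s⁻¹ k≤p) =
  true ∷ q , s⊆s q⊆p , cong suc ∣q∣≡k
subset-of-size (false ∷ p) (suc k) k≤p with q , q⊆p , ∣q∣≡k ← subset-of-size p (suc k) k≤p =
  false ∷ q , s⊆s q⊆p , ∣q∣≡k

enumerate : ∀ {n} (p : Subset n) k → k ≤ ∣ p ∣ →
  ∃ λ (g : Fin k → Fin n) → Injective _≡_ _≡_ g × (∀ i → g i ∈ p)
enumerate p           zero    _   = (λ ()) , (λ { {()} }) , λ ()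
enumerate (false ∷ p) (suc k) k≤p with g , inj , g∈ ← enumerate p (suc k) k≤p =
  suc ∘ g , inj ∘ suc-injective , there ∘ g∈
enumerate {suc n} (true ∷ p) (suc k) k≤p with g , inj , g∈ ← enumerate p k (s≤s⁻¹ k≤p) =
  g′ , inj′ , g′∈
  where
  g′ : Fin (suc k) → Fin (suc n)
  g′ zero    = zero
  g′ (suc i) = suc (g i)
  inj′ : Injective _≡_ _≡_ g′
  inj′ {zero}  {zero}  _  = refl
  inj′ {suc i} {suc j} eq = cong suc (inj (suc-injective eq))
  g′∈ : ∀ i → g′ i ∈ true ∷ p
  g′∈ zero    = here
  g′∈ (suc i) = there (g∈ i)

0<∣p∣⇒Nonempty : ∀ {n} (p : Subset n) → 0 < ∣ p ∣ → Nonempty p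
0<∣p∣⇒Nonempty p 0<p with g , _ , g∈ ← enumerate p 1 0<p = g zero , g∈ zero

-- Subsets of a disjoint union

module _ {a b : ℕ} where

  ∈-++⁺ˡ : ∀ {p : Subset a} (q : Subset b) {i} → i ∈ p → i ↑ˡ b ∈ p ++ q
  ∈-++⁺ˡ {p} q {i} i∈p = lookup⇒[]= _ _ (trans (lookup-++ˡ p q i) ([]=⇒lookup i∈p))

  ∈-++⁺ʳ : ∀ (p : Subset a) {q : Subset b} {j} → j ∈ q → a ↑ʳ j ∈ p ++ q
  ∈-++⁺ʳ p {q} {j} j∈q = lookup⇒[]= _ _ (trans (lookup-++ʳ p q j) ([]=⇒lookup j∈q))

  ∈-++⁻ˡ : ∀ {p : Subset a} (q : Subset b) {i} → i ↑ˡ b ∈ p ++ q → i ∈ p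
  ∈-++⁻ˡ {p} q {i} i∈ = lookup⇒[]= _ _ (trans (sym (lookup-++ˡ p q i)) ([]=⇒lookup i∈))

  ∈-++⁻ʳ : ∀ (p : Subset a) {q : Subset b} {j} → a ↑ʳ j ∈ p ++ q → j ∈ q
  ∈-++⁻ʳ p {q} {j} j∈ = lookup⇒[]= _ _ (trans (sym (lookup-++ʳ p q j)) ([]=⇒lookup j∈))

  take-++ : (p : Subset a) (q : Subset b) → take a (p ++ q) ≡ p
  take-++ p q = ++-injectiveˡ (take a (p ++ q)) p (take++drop≡id a (p ++ q))

  drop-++ : (p : Subset a) (q : Subset b) → drop a (p ++ q) ≡ q
  drop-++ p q = ++-injectiveʳ (take a (p ++ q)) p (take++drop≡id a (p ++ q))

  ∪-++ : (p p′ : Subset a) (q q′ : Subset b) → (p ++ q) ∪ (p′ ++ q′) ≡ (p ∪ p′) ++ (q ∪ q′)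
  ∪-++ p p′ q q′ = zipWith-++ _∨_ p q p′ q′

data Sides {a b} : Fin (a + b) → Set where
  left  : (i : Fin a) → Sides (i ↑ˡ b)
  right : (j : Fin b) → Sides (a ↑ʳ j)

sides : ∀ a {b} (x : Fin (a + b)) → Sides {a} {b} x
sides zero    x       = right x
sides (suc a) zero    = left zero
sides (suc a) (suc x) with sides a x
... | left i  = left (suc i)
... | right j = right j

∣p++q∣≡∣p∣+∣q∣ : ∀ {a b} (p : Subset a) (q : Subset b) → ∣ p ++ q ∣ ≡ ∣ p ∣ + ∣ q ∣
∣p++q∣≡∣p∣+∣q∣ []          q = refl
∣p++q∣≡∣p∣+∣q∣ (true  ∷ p) q = cong suc (∣p++q∣≡∣p∣+∣q∣ p q)
∣p++q∣≡∣p∣+∣q∣ (false ∷ p) q = ∣p++q∣≡∣p∣+∣q∣ p q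

⊥++⊥≡⊥ : ∀ a {b} → ⊥ {a} ++ ⊥ {b} ≡ ⊥
⊥++⊥≡⊥ zero    = refl
⊥++⊥≡⊥ (suc a) = cong (false ∷_) (⊥++⊥≡⊥ a)

⁅i↑ˡ⁆ : ∀ {a} b (i : Fin a) → ⁅ i ↑ˡ b ⁆ ≡ ⁅ i ⁆ ++ ⊥
⁅i↑ˡ⁆ {suc a} b zero    = cong (true ∷_) (sym (⊥++⊥≡⊥ a))
⁅i↑ˡ⁆ {suc a} b (suc i) = cong (false ∷_) (⁅i↑ˡ⁆ b i)

⁅↑ʳj⁆ : ∀ a {b} (j : Fin b) → ⁅ a ↑ʳ j ⁆ ≡ ⊥ {a} ++ ⁅ j ⁆
⁅↑ʳj⁆ zero    j = refl
⁅↑ʳj⁆ (suc a) j = cong (false ∷_) (⁅↑ʳj⁆ a j)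

-- Images

∈-image⁺ : ∀ {a b} (f : Fin a → Fin b) (X : Subset a) {i} → i ∈ X → f i ∈ image f X
∈-image⁺ f (true ∷ X) here      = p⊆p∪q _ (x∈⁅x⁆ (f zero))
∈-image⁺ f (x ∷ X) (there i∈X) = q⊆p∪q _ _ (∈-image⁺ (f ∘ suc) X i∈X)

∈-image⁻ : ∀ {a b} (f : Fin a → Fin b) (X : Subset a) {y} → y ∈ image f X → ∃ λ i → i ∈ X × f i ≡ y
∈-image⁻ f []         y∈ = contradiction y∈ ∉⊥
∈-image⁻ f (true ∷ X) y∈ with x∈p∪q⁻ ⁅ f zero ⁆ _ y∈
... | inj₁ y∈₀ = zero , here , sym (x∈⁅y⁆⇒x≡y (f zero) y∈₀)
... | inj₂ y∈₊ with i , i∈X , eq ← ∈-image⁻ (f ∘ suc) X y∈₊ = suc i , there i∈X , eq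
∈-image⁻ f (false ∷ X) y∈ with x∈p∪q⁻ ⊥ _ y∈
... | inj₁ y∈₀ = contradiction y∈₀ ∉⊥
... | inj₂ y∈₊ with i , i∈X , eq ← ∈-image⁻ (f ∘ suc) X y∈₊ = suc i , there i∈X , eq

image-⊆ : ∀ {a b} (f : Fin a → Fin b) (X : Subset a) {Y} → (∀ {i} → i ∈ X → f i ∈ Y) → image f X ⊆ Y
image-⊆ f X f∈ y∈ with i , i∈X , refl ← ∈-image⁻ f X y∈ = f∈ i∈X

image-∪ : ∀ {a b} (f : Fin a → Fin b) (X Y : Subset a) → image f (X ∪ Y) ≡ image f X ∪ image f Y
image-∪ f X Y = ⊆-antisym
  (image-⊆ f (X ∪ Y) λ i∈ → x∈p∪q⁺ ([ inj₁ ∘ ∈-image⁺ f X , inj₂ ∘ ∈-image⁺ f Y ]′ (x∈p∪q⁻ X Y i∈)))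
  (∪-lub (image-⊆ f X (∈-image⁺ f (X ∪ Y) ∘ p⊆p∪q Y))
         (image-⊆ f Y (∈-image⁺ f (X ∪ Y) ∘ q⊆p∪q X Y)))

image-∘ : ∀ {a b c} (f : Fin b → Fin c) (g : Fin a → Fin b) (X : Subset a) →
  image f (image g X) ≡ image (f ∘ g) X
image-∘ f g X = ⊆-antisym
  (image-⊆ f (image g X) λ i∈ → let j , j∈X , eq = ∈-image⁻ g X i∈ in
    subst (λ i → f i ∈ image (f ∘ g) X) eq (∈-image⁺ (f ∘ g) X j∈X))
  (image-⊆ (f ∘ g) X (∈-image⁺ f (image g X) ∘ ∈-image⁺ g X))

image-⁅⁆ : ∀ {a b} (f : Fin a → Fin b) i → image f ⁅ i ⁆ ≡ ⁅ f i ⁆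
image-⁅⁆ f i = ⊆-antisym
  (image-⊆ f ⁅ i ⁆ λ j∈ → subst (λ j → f j ∈ ⁅ f i ⁆) (sym (x∈⁅y⁆⇒x≡y i j∈)) (x∈⁅x⁆ (f i)))
  (x∈p⇒⁅x⁆⊆p (∈-image⁺ f ⁅ i ⁆ (x∈⁅x⁆ i)))

∣image∣ : ∀ {a b} (f : Fin a → Fin b) → Injective _≡_ _≡_ f → ∀ X → ∣ image f X ∣ ≡ ∣ X ∣
∣image∣ {b = b} f inj []          = ∣⊥∣≡0 b
∣image∣ f inj (true  ∷ X) = begin
  ∣ ⁅ f zero ⁆ ∪ image (f ∘ suc) X ∣      ≡⟨ ∣p∪q∣≡∣p∣+∣q∣ ⁅ f zero ⁆ _ fresh ⟩
  ∣ ⁅ f zero ⁆ ∣ + ∣ image (f ∘ suc) X ∣  ≡⟨ cong₂ _+_ (∣⁅x⁆∣≡1 (f zero)) (∣image∣ (f ∘ suc) (suc-injective ∘ inj) X) ⟩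
  suc ∣ X ∣                               ∎
  where
  open ≡-Reasoning
  fresh : ∀ {y} → y ∈ ⁅ f zero ⁆ → y ∉ image (f ∘ suc) X
  fresh y∈₀ y∈₊ with i , _ , eq ← ∈-image⁻ (f ∘ suc) X y∈₊ =
    0≢1+n (inj (sym (trans eq (x∈⁅y⁆⇒x≡y (f zero) y∈₀))))
∣image∣ f inj (false ∷ X) =
  trans (cong ∣_∣ (∪-identityˡ (image (f ∘ suc) X))) (∣image∣ (f ∘ suc) (suc-injective ∘ inj) X)

-- Were every point hit, choosing preimages would inject `Fin b` into `Fin a`.
missed-point : ∀ {a b} (f : Fin a → Fin b) → a < b → ∃ λ y → ∀ i → f i ≢ y
missed-point {b = b} f a<b with all? (λ y → any? (λ i → f i ≟ᶠ y))
... | yes onto = contradiction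
  (injective⇒≤ {f = proj₁ ∘ onto} λ {x} {y} eq → trans (sym (proj₂ (onto x))) (trans (cong f eq) (proj₂ (onto y))))
  (<⇒≱ a<b)
... | no ¬onto with y , y∉f ← ¬∀⟶∃¬ b _ (λ y → any? (λ i → f i ≟ᶠ y)) ¬onto = y , λ i eq → y∉f (i , eq)

-- Links `del` and `con`, which are defined through `insertAt`, to precomposition of an embedding
-- with `punchIn v`.
image-insertAt : ∀ {a b} (f : Fin (suc a) → Fin b) (X : Subset a) v s →
  image f (insertAt X v s) ≡ image (f ∘ punchIn v) X ∪ (if s then ⁅ f v ⁆ else ⊥)
image-insertAt f X       zero    s = ∪-comm (if s then ⁅ f zero ⁆ else ⊥) (image (f ∘ suc) X)
image-insertAt f (x ∷ X) (suc v) s = trans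
  (cong (_ ∪_) (image-insertAt (f ∘ suc) X v s))
  (sym (∪-assoc (if x then ⁅ f zero ⁆ else ⊥) (image (f ∘ suc ∘ punchIn v) X) _))

-- Independence, rank and truncation

Hereditary : ∀ {n} → IndepFn n → Set
Hereditary M = ∀ {X Y} → Y ⊆ X → Indep M X → Indep M Y

allᵇ⇔∀ : ∀ {n} (f : Fin n → Bool) → T (allᵇ f) ⇔ (∀ i → T (f i))
allᵇ⇔∀ {zero}  f = mk⇔ (λ _ ()) (λ _ → tt)
allᵇ⇔∀ {suc n} f = mk⇔
  (λ t → let t₀ , t₊ = to T-∧ t in λ { zero → t₀ ; (suc i) → to (allᵇ⇔∀ (f ∘ suc)) t₊ i })
  (λ ∀f → from T-∧ (∀f zero , from (allᵇ⇔∀ (f ∘ suc)) (∀f ∘ suc)))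

T-not⁺ : ∀ {b} → ¬ T b → T (not b)
T-not⁺ {true}  ¬b = ¬b tt
T-not⁺ {false} ¬b = tt

T-not⁻ : ∀ {b} → T (not b) → ¬ T b
T-not⁻ {false} _ ()

isBaseᵇ⇔IsBase : ∀ {n} (M : IndepFn n) X → T (isBaseᵇ M X) ⇔ IsBase M X
isBaseᵇ⇔IsBase M X = mk⇔ sound complete
  where
  sound : T (isBaseᵇ M X) → IsBase M X
  sound t with X-ind , t′ ← to T-∧ t = X-ind , λ y y∉X Xy-ind →
    [ (λ y∈X → y∉X (lookup⇒[]= y X (to T-≡ y∈X))) , (λ ¬ind → T-not⁻ ¬ind Xy-ind) ]′
      (to T-∨ (to (allᵇ⇔∀ _) t′ y))
  complete : IsBase M X → T (isBaseᵇ M X)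
  complete (X-ind , max) = from T-∧ (X-ind , from (allᵇ⇔∀ _) λ y → from T-∨ (case y))
    where
    case : ∀ y → T (lookup X y) ⊎ T (not (M (X ∪ ⁅ y ⁆)))
    case y with y ∈? X
    ... | yes y∈X = inj₁ (from T-≡ ([]=⇒lookup y∈X))
    ... | no  y∉X = inj₂ (T-not⁺ (max y y∉X))

module _ {n} {M : IndepFn n} (isM : IsMatroid M) where
  open IsMatroid isM

  -- Augmentation repeated `d` times, `d` being the size gap on which the recursion runs. The bound
  -- `Z ⊆ X ∪ Y` is kept so that a point missed by both `X` and `Y` is also missed by `Z`.
  augment-from : ∀ d X Y → Indep M X → Indep M Y → ∣ Y ∣ ≡ d + ∣ X ∣ →
    ∃ λ Z → Indep M Z × X ⊆ Z × Z ⊆ X ∪ Y × ∣ Z ∣ ≡ ∣ Y ∣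
  augment-from zero    X Y X-ind Y-ind eq = X , X-ind , ⊆-refl , p⊆p∪q Y , sym eq
  augment-from (suc d) X Y X-ind Y-ind eq
    with y , y∈Y , y∉X , Xy-ind ← augment X Y X-ind Y-ind (subst (∣ X ∣ <_) (sym eq) (s≤s (m≤n+m _ d)))
    with Z , Z-ind , Xy⊆Z , Z⊆ , ∣Z∣≡ ← augment-from d (X ∪ ⁅ y ⁆) Y Xy-ind Y-ind
           (trans eq (trans (sym (+-suc d _)) (cong (d +_) (sym (x∉p⇒∣p∪⁅x⁆∣≡1+∣p∣ X y y∉X))))) =
    Z , Z-ind , Xy⊆Z ∘ p⊆p∪q _ , ∪-lub (p∪⁅x⁆⊆ (p⊆p∪q Y) (q⊆p∪q X Y y∈Y)) (q⊆p∪q X Y) ∘ Z⊆ , ∣Z∣≡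

  ∣indep∣≤∣base∣ : ∀ {B X} → IsBase M B → Indep M X → ∣ X ∣ ≤ ∣ B ∣
  ∣indep∣≤∣base∣ {B} {X} (B-ind , max) X-ind = ≮⇒≥ λ B<X →
    let y , _ , y∉B , By-ind = augment B X B-ind X-ind B<X in max y y∉B By-ind

  base-contains : ∀ {e r} → HasRank M r → Indep M ⁅ e ⁆ → ∃ λ B → Indep M B × ∣ B ∣ ≡ r × e ∈ B
  base-contains {e} (B , B-base , refl) e-ind
    with Z , Z-ind , e⊆Z , _ , ∣Z∣≡ ← augment-from (∣ B ∣ ∸ ∣ ⁅ e ⁆ ∣) ⁅ e ⁆ B e-ind (proj₁ B-base)
           (sym (m∸n+n≡m (∣indep∣≤∣base∣ B-base e-ind))) =
    Z , Z-ind , ∣Z∣≡ , e⊆Z (x∈⁅x⁆ e)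

-- The two hypotheses say that every maximal independent set of `P` has size `R`, so each truncation
-- removes exactly the sets of the current top size. Writing `∣ X ∣ + j ≤ R` avoids a truncated
-- subtraction and stays correct when `j` exceeds `R`.
τ^-indep : ∀ {n} (P : IndepFn n) R →
  (∀ X → Indep P X → ∣ X ∣ ≤ R) →
  (∀ X → Indep P X → ∣ X ∣ < R → ∃ λ y → y ∉ X × Indep P (X ∪ ⁅ y ⁆)) →
  ∀ j X → Indep (τ^ j P) X ⇔ (Indep P X × ∣ X ∣ + j ≤ R)
τ^-indep P R bound extend zero    X = mk⇔
  (λ X-ind → X-ind , subst (_≤ R) (sym (+-identityʳ ∣ X ∣)) (bound X X-ind)) proj₁
τ^-indep P R bound extend (suc j) X = mk⇔ forward backward
  where
  IH = τ^-indep P R bound extend j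

  forward : Indep (τ^ (suc j) P) X → Indep P X × ∣ X ∣ + suc j ≤ R
  -- If `∣ X ∣ + j` had already reached `R`, every one-point extension would be too large, which
  -- makes `X` a base of `τ^ j P`.
  forward t with X-ind , ¬base ← to T-∧ t with X-indP , X≤R ← to (IH X) X-ind =
    X-indP , subst (_≤ R) (sym (+-suc ∣ X ∣ j)) (≰⇒> λ R≤X →
      T-not⁻ ¬base (from (isBaseᵇ⇔IsBase (τ^ j P) X) (X-ind , λ y y∉X Xy-ind →
        <⇒≱ (subst (λ c → c + j ≤ R) (x∉p⇒∣p∪⁅x⁆∣≡1+∣p∣ X y y∉X) (proj₂ (to (IH (X ∪ ⁅ y ⁆)) Xy-ind))) R≤X)))

  backward : Indep P X × ∣ X ∣ + suc j ≤ R → Indep (τ^ (suc j) P) X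
  backward (X-indP , X<R) = from T-∧
    ( from (IH X) (X-indP , <⇒≤ Xj<R)
    , T-not⁺ λ base →
        let y , y∉X , Xy-indP = extend X X-indP (≤-<-trans (m≤m+n ∣ X ∣ j) Xj<R) in
        proj₂ (to (isBaseᵇ⇔IsBase (τ^ j P) X) base) y y∉X
          (from (IH (X ∪ ⁅ y ⁆)) (Xy-indP , subst (λ c → c + j ≤ R) (sym (x∉p⇒∣p∪⁅x⁆∣≡1+∣p∣ X y y∉X)) Xj<R)))
    where
    Xj<R : ∣ X ∣ + j < R
    Xj<R = subst (_≤ R) (+-suc ∣ X ∣ j) X<R

⊕U-indep : ∀ {a b} (N : IndepFn a) r (X : Subset a) (Y : Subset b) →
  Indep (N ⊕ U r b) (X ++ Y) ⇔ (Indep N X × ∣ Y ∣ ≤ r)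
⊕U-indep N r X Y rewrite take-++ X Y | drop-++ X Y = mk⇔
  (λ t → let X-ind , Y≤r = to T-∧ t in X-ind , ≤ᵇ⇒≤ _ _ Y≤r)
  (λ (X-ind , Y≤r) → from T-∧ (X-ind , ≤⇒≤ᵇ Y≤r))

-- Reduces claims about subsets of a disjoint union to pairs of parts, the form in which
-- independence is described below.
++-elim : ∀ {a b} (P : Subset (a + b) → Set) → (∀ X Y → P (X ++ Y)) → ∀ X → P X
++-elim {a} P P++ X = subst P (take++drop≡id a X) (P++ (take a X) (drop a X))

module _ {n} {N : IndepFn n} (isN : IsMatroid N) {r} (rank : HasRank N r) (r≤n : r ≤ n) where
  open IsMatroid isN

  -- The direct sum has rank `r + r`, and `m` truncations lower this to `r + k` because `r ≡ k + m`.
  -- The proof adds `m` to both sides of the size bound instead of subtracting.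
  τ^-⊕U-indep : ∀ k m → r ≡ k + m → ∀ X Y →
    Indep (τ^ m (N ⊕ U r n)) (X ++ Y) ⇔ (Indep N X × ∣ Y ∣ ≤ r × ∣ X ∣ + ∣ Y ∣ ≤ r + k)
  τ^-⊕U-indep k m refl X Y = mk⇔
    (λ t → let XY-ind , ≤R = to spec t ; X-ind , Y≤r = to (⊕U-indep N r X Y) XY-ind in
      X-ind , Y≤r , +-cancelʳ-≤ m _ _ (subst (∣ X ∣ + ∣ Y ∣ + m ≤_) (sym (+-assoc r k m))
        (subst (λ c → c + m ≤ r + r) (∣p++q∣≡∣p∣+∣q∣ X Y) ≤R)))
    (λ (X-ind , Y≤r , ≤r+k) → from spec (from (⊕U-indep N r X Y) (X-ind , Y≤r) ,
      subst (λ c → c + m ≤ r + r) (sym (∣p++q∣≡∣p∣+∣q∣ X Y))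
        (subst (∣ X ∣ + ∣ Y ∣ + m ≤_) (+-assoc r k m) (+-monoˡ-≤ m ≤r+k))))
    where
    P : IndepFn (n + n)
    P = N ⊕ U r n
    B = proj₁ rank
    B-base = proj₁ (proj₂ rank)
    ∣B∣≡r = proj₂ (proj₂ rank)

    ∣indep∣≤r : ∀ {X} → Indep N X → ∣ X ∣ ≤ r
    ∣indep∣≤r X-ind = subst (_ ≤_) ∣B∣≡r (∣indep∣≤∣base∣ isN B-base X-ind)

    bound : ∀ X → Indep P X → ∣ X ∣ ≤ r + r
    bound = ++-elim {n} (λ X → Indep P X → ∣ X ∣ ≤ r + r) λ X Y XY-ind →
      let X-ind , Y≤r = to (⊕U-indep N r X Y) XY-ind in
      subst (_≤ r + r) (sym (∣p++q∣≡∣p∣+∣q∣ X Y)) (+-mono-≤ (∣indep∣≤r X-ind) Y≤r)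

    right-room : ∀ X Y → r ≤ ∣ X ∣ → ∣ X ++ Y ∣ < r + r → ∣ Y ∣ < r
    right-room X Y r≤X XY<R = +-cancelˡ-< r _ _
      (≤-<-trans (+-monoˡ-≤ ∣ Y ∣ r≤X) (subst (_< r + r) (∣p++q∣≡∣p∣+∣q∣ X Y) XY<R))

    extend : ∀ X → Indep P X → ∣ X ∣ < r + r → ∃ λ y → y ∉ X × Indep P (X ∪ ⁅ y ⁆)
    extend = ++-elim {n} (λ X → Indep P X → ∣ X ∣ < r + r → ∃ λ y → y ∉ X × Indep P (X ∪ ⁅ y ⁆)) go
      where
      go : ∀ X Y → Indep P (X ++ Y) → ∣ X ++ Y ∣ < r + r → ∃ λ y → y ∉ X ++ Y × Indep P ((X ++ Y) ∪ ⁅ y ⁆)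
      go X Y XY-ind XY<R with X-ind , Y≤r ← to (⊕U-indep N r X Y) XY-ind with ∣ X ∣ <? r
      ... | yes X<r
        with y , _ , y∉X , Xy-ind ← augment X B X-ind (proj₁ B-base) (subst (∣ X ∣ <_) (sym ∣B∣≡r) X<r) =
        y ↑ˡ n , y∉X ∘ ∈-++⁻ˡ Y ,
        subst (Indep P) (sym (trans (cong ((X ++ Y) ∪_) (⁅i↑ˡ⁆ n y)) (∪-++ X _ Y _)))
          (from (⊕U-indep N r _ _) (Xy-ind , subst (λ Z → ∣ Z ∣ ≤ r) (sym (∪-identityʳ Y)) Y≤r))
      -- The left part is already a basis, so the shortfall is on the right; `r ≤ n` then supplies a
      -- free point of the uniform summand.
      ... | no X≮r with Y<r ← right-room X Y (≮⇒≥ X≮r) XY<R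
        with y , y∉Y ← ∣p∣<n⇒∃∉ Y (<-≤-trans Y<r r≤n) =
        n ↑ʳ y , y∉Y ∘ ∈-++⁻ʳ X ,
        subst (Indep P) (sym (trans (cong ((X ++ Y) ∪_) (⁅↑ʳj⁆ n y)) (∪-++ X _ Y _)))
          (from (⊕U-indep N r _ _)
            ( subst (Indep N) (sym (∪-identityʳ X)) X-ind
            , subst (_≤ r) (sym (x∉p⇒∣p∪⁅x⁆∣≡1+∣p∣ Y y y∉Y)) Y<r))

    spec : Indep (τ^ m P) (X ++ Y) ⇔ (Indep P (X ++ Y) × ∣ X ++ Y ∣ + m ≤ r + r)
    spec = τ^-indep P (r + r) bound extend m (X ++ Y)

-- Minors

∣p∣≤0⇔Empty : ∀ {n} (p : Subset n) → ∣ p ∣ ≤ 0 ⇔ (∀ x → x ∉ p)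
∣p∣≤0⇔Empty {n} p = mk⇔
  (λ p≤0 x x∈p → n≮0 (≤-trans (≤-reflexive (sym (∣⁅x⁆∣≡1 x))) (≤-trans (p⊆q⇒∣p∣≤∣q∣ (x∈p⇒⁅x⁆⊆p x∈p)) p≤0)))
  (λ empty → ≤-reflexive (trans (cong ∣_∣ (Empty-unique λ (x , x∈p) → empty x x∈p)) (∣⊥∣≡0 n)))

-- `U k k` is free and so imposes no condition; only the `l` loops obstruct independence.
Uₖₖ⊕U₀ₗ-indep : ∀ k l X → Indep (U k k ⊕ U 0 l) X ⇔ (∀ j → k ↑ʳ j ∉ X)
Uₖₖ⊕U₀ₗ-indep k l = ++-elim {k} {l} (λ X → Indep (U k k ⊕ U 0 l) X ⇔ (∀ j → k ↑ʳ j ∉ X)) λ X Y → mk⇔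
  (λ t j j∈ → to (∣p∣≤0⇔Empty Y) (proj₂ (to (⊕U-indep (U k k) 0 X Y) t)) j (∈-++⁻ʳ X j∈))
  (λ loops → from (⊕U-indep (U k k) 0 X Y)
    (≤⇒≤ᵇ (∣p∣≤n X) , from (∣p∣≤0⇔Empty Y) λ j → loops j ∘ ∈-++⁺ʳ X))

con-nonloop : ∀ {n} (M : IndepFn (suc n)) v → Indep M ⁅ v ⁆ → ∀ X → (M con v) X ≡ M (insertAt X v true)
con-nonloop M v v-ind X rewrite to T-≡ v-ind = refl

-- For B independent in M: N ≅ (M / B) restricted to the image of f.
record Embeds {n n′} (M : IndepFn n) (N : IndepFn n′) (f : Fin n′ → Fin n) (B : Subset n) : Set where
  field
    injective : Injective _≡_ _≡_ f
    disjoint  : ∀ i → f i ∉ B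
    indep     : ∀ X → N X ≡ M (image f X ∪ B)

open Embeds

-- Contracting `C` agrees, off `C`, with contracting its basis `B` and deleting the other points of
-- `C`, which have become loops. So `B` alone records the minor.
hasMinor⇒embeds : ∀ {n n′} {M : IndepFn n} {N : IndepFn n′} → HasMinor M N →
  ∃ λ f → ∃ λ B → Embeds M N f B
hasMinor⇒embeds (f , inj , C , f∉C , B , B⊆C , _ , _ , eq) = f , B , record
  { injective = inj ; disjoint = λ i → f∉C i ∘ B⊆C ; indep = eq }

module _ {n n′} {M : IndepFn n} {M′ : IndepFn n′} {f B} (E : Embeds M M′ f B) where

  embeds-trans : ∀ {n″} {M″ : IndepFn n″} {g B′} → Embeds M′ M″ g B′ →
    Embeds M M″ (f ∘ g) (image f B′ ∪ B)
  embeds-trans {g = g} {B′} E′ = record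
    { injective = injective E′ ∘ injective E
    ; disjoint  = λ i fgi∈ → [ fresh i , disjoint E (g i) ]′ (x∈p∪q⁻ (image f B′) B fgi∈)
    ; indep     = λ X → trans (indep E′ X) (trans (indep E (image g X ∪ B′)) (cong M (union X)))
    }
    where
    fresh : ∀ i → f (g i) ∉ image f B′
    fresh i fgi∈ with j , j∈B′ , eq ← ∈-image⁻ f B′ fgi∈ =
      disjoint E′ i (subst (_∈ B′) (injective E eq) j∈B′)
    union : ∀ X → image f (image g X ∪ B′) ∪ B ≡ image (f ∘ g) X ∪ (image f B′ ∪ B)
    union X = begin
      image f (image g X ∪ B′) ∪ B          ≡⟨ cong (_∪ B) (image-∪ f (image g X) B′) ⟩
      (image f (image g X) ∪ image f B′) ∪ B ≡⟨ cong (λ Y → (Y ∪ image f B′) ∪ B) (image-∘ f g X) ⟩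
      (image (f ∘ g) X ∪ image f B′) ∪ B     ≡⟨ ∪-assoc (image (f ∘ g) X) (image f B′) B ⟩
      image (f ∘ g) X ∪ (image f B′ ∪ B)     ∎
      where open ≡-Reasoning

module _ {n n′} {M : IndepFn n} {M′ : IndepFn (suc n′)} {f B} (E : Embeds M M′ f B) (v : Fin (suc n′)) where

  embeds-del : Embeds M (M′ del v) (f ∘ punchIn v) B
  embeds-del = record
    { injective = punchIn-injective v _ _ ∘ injective E
    ; disjoint  = disjoint E ∘ punchIn v
    ; indep     = λ X → trans (indep E (insertAt X v false)) (cong (λ Y → M (Y ∪ B))
        (trans (image-insertAt f X v false) (∪-identityʳ (image (f ∘ punchIn v) X))))
    }

  embeds-con : Indep M′ ⁅ v ⁆ → Embeds M (M′ con v) (f ∘ punchIn v) (⁅ f v ⁆ ∪ B)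
  embeds-con v-ind = record
    { injective = punchIn-injective v _ _ ∘ injective E
    ; disjoint  = λ i fi∈ → [ punchInᵢ≢i v i ∘ injective E ∘ x∈⁅y⁆⇒x≡y (f v) , disjoint E (punchIn v i) ]′
        (x∈p∪q⁻ ⁅ f v ⁆ B fi∈)
    ; indep     = λ X → trans (con-nonloop M′ v v-ind X) (trans (indep E (insertAt X v true)) (cong M
        (trans (cong (_∪ B) (image-insertAt f X v true)) (∪-assoc (image (f ∘ punchIn v) X) ⁅ f v ⁆ B))))
    }

module _ {n} {M : IndepFn n} k l {h : Fin (k + l) → Fin n} {B} (E : Embeds M (U k k ⊕ U 0 l) h B) where

  -- The points of `M` that carry the `U 0 l` summand; they are loops of `M / B`.
  loops : Subset n
  loops = image (h ∘ (k ↑ʳ_)) ⊤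

  ∣loops∣ : ∣ loops ∣ ≡ l
  ∣loops∣ = trans (∣image∣ _ (↑ʳ-injective k _ _ ∘ injective E) ⊤) (∣⊤∣≡n l)

  loops-fresh : ∀ {x} → x ∈ loops → x ∉ B
  loops-fresh x∈ with j , _ , refl ← ∈-image⁻ (h ∘ (k ↑ʳ_)) ⊤ x∈ = disjoint E (k ↑ʳ j)

  loops-dep : ∀ {x} → x ∈ loops → ¬ Indep M (B ∪ ⁅ x ⁆)
  loops-dep x∈ Bx-ind with j , _ , refl ← ∈-image⁻ (h ∘ (k ↑ʳ_)) ⊤ x∈ =
    to (Uₖₖ⊕U₀ₗ-indep k l ⁅ k ↑ʳ j ⁆)
      (subst T (sym (trans (indep E _) (cong M (trans (cong (_∪ B) (image-⁅⁆ h _)) (∪-comm ⁅ h _ ⁆ B))))) Bx-ind)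
      j (x∈⁅x⁆ (k ↑ʳ j))

  -- The image of the free summand enlarges `B` by `k` points, which bounds the corank of `B` from
  -- below.
  coloops-indep : ∃ λ I → Indep M I × B ⊆ I × ∣ I ∣ ≡ k + ∣ B ∣
  coloops-indep = image h K ∪ B
    , subst T (indep E K) (from (Uₖₖ⊕U₀ₗ-indep k l K) λ j j∈ → ∉⊥ (∈-++⁻ʳ (⊤ {k}) j∈))
    , q⊆p∪q (image h K) B
    , (begin
        ∣ image h K ∪ B ∣      ≡⟨ ∣p∪q∣≡∣p∣+∣q∣ (image h K) B fresh ⟩
        ∣ image h K ∣ + ∣ B ∣  ≡⟨ cong (_+ ∣ B ∣) (trans (∣image∣ h (injective E) K) ∣K∣) ⟩
        k + ∣ B ∣              ∎)
    where
    open ≡-Reasoning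
    K : Subset (k + l)
    K = ⊤ {k} ++ ⊥
    ∣K∣ : ∣ K ∣ ≡ k
    ∣K∣ = trans (∣p++q∣≡∣p∣+∣q∣ (⊤ {k}) (⊥ {l})) (trans (cong₂ _+_ (∣⊤∣≡n k) (∣⊥∣≡0 l)) (+-identityʳ k))
    fresh : ∀ {x} → x ∈ image h K → x ∉ B
    fresh x∈ with i , _ , refl ← ∈-image⁻ h K x∈ = disjoint E i

-- Contract `B`: then `K` is independent and `L` consists of loops, and `k` points of the one with
-- `l` points of the other form the minor. `L` avoids `B ∪ K` automatically, since a common point
-- would be independent over `B`.
hasMinor-Uₖₖ⊕U₀ₗ : ∀ {n} {M : IndepFn n} → Hereditary M → ∀ {k l} B K L →
  Indep M (B ∪ K) → (∀ {x} → x ∈ K → x ∉ B) → (∀ {x} → x ∈ L → ¬ Indep M (B ∪ ⁅ x ⁆)) →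
  k ≤ ∣ K ∣ → l ≤ ∣ L ∣ → HasMinor M (U k k ⊕ U 0 l)
hasMinor-Uₖₖ⊕U₀ₗ {n} {M} her {k} {l} B K L BK-ind K-fresh L-dep k≤K l≤L
  with κ , κ-inj , κ∈K ← enumerate K k k≤K
  with ƛ , ƛ-inj , ƛ∈L ← enumerate L l l≤L =
  f , f-inj , B , f∉B , B , ⊆-refl , her (p⊆p∪q K) BK-ind , (λ y y∈B y∉B → contradiction y∈B y∉B) , spec
  where
  L∉BK : ∀ {x} → x ∈ L → x ∉ B ∪ K
  L∉BK x∈L x∈BK = L-dep x∈L (her (p∪⁅x⁆⊆ (p⊆p∪q K) x∈BK) BK-ind)

  f : Fin (k + l) → Fin n
  f x = [ κ , ƛ ]′ (splitAt k x)

  fˡ : ∀ i → f (i ↑ˡ l) ≡ κ i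
  fˡ i = cong [ κ , ƛ ]′ (splitAt-↑ˡ k i l)

  fʳ : ∀ j → f (k ↑ʳ j) ≡ ƛ j
  fʳ j = cong [ κ , ƛ ]′ (splitAt-↑ʳ k l j)

  κ≢ƛ : ∀ i j → κ i ≢ ƛ j
  κ≢ƛ i j eq = L∉BK (ƛ∈L j) (subst (_∈ B ∪ K) eq (q⊆p∪q B K (κ∈K i)))

  f-inj : Injective _≡_ _≡_ f
  f-inj {x} {y} eq with sides k x | sides k y
  ... | left  i | left  i′ = cong (_↑ˡ l) (κ-inj (trans (sym (fˡ i)) (trans eq (fˡ i′))))
  ... | left  i | right j′ = contradiction (trans (sym (fˡ i)) (trans eq (fʳ j′))) (κ≢ƛ i j′)
  ... | right j | left  i′ = contradiction (trans (sym (fˡ i′)) (trans (sym eq) (fʳ j))) (κ≢ƛ i′ j)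
  ... | right j | right j′ = cong (k ↑ʳ_) (ƛ-inj (trans (sym (fʳ j)) (trans eq (fʳ j′))))

  f∉B : ∀ x → f x ∉ B
  f∉B x with sides k x
  ... | left  i rewrite fˡ i = K-fresh (κ∈K i)
  ... | right j rewrite fʳ j = L∉BK (ƛ∈L j) ∘ p⊆p∪q K

  T-injective : ∀ {b c} → (T b → T c) → (T c → T b) → b ≡ c
  T-injective {true}  {true}  _ _ = refl
  T-injective {true}  {false} p _ = ⊥-elim (p tt)
  T-injective {false} {true}  _ q = ⊥-elim (q tt)
  T-injective {false} {false} _ _ = refl

  spec : ∀ X → (U k k ⊕ U 0 l) X ≡ M (image f X ∪ B)
  spec X = T-injective
    (λ X-ind → her (∪-lub (image-⊆ f X λ {x} x∈X → inK x x∈X (to (Uₖₖ⊕U₀ₗ-indep k l X) X-ind)) (p⊆p∪q K)) BK-ind)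
    (λ X-ind → from (Uₖₖ⊕U₀ₗ-indep k l X) λ j j∈X →
      L-dep (ƛ∈L j) (her (p∪⁅x⁆⊆ (q⊆p∪q (image f X) B)
        (p⊆p∪q B (subst (_∈ image f X) (fʳ j) (∈-image⁺ f X j∈X)))) X-ind))
    where
    inK : ∀ x → x ∈ X → (∀ j → k ↑ʳ j ∉ X) → f x ∈ B ∪ K
    inK x x∈X noloop with sides k x
    ... | left  i = subst (_∈ B ∪ K) (sym (fˡ i)) (q⊆p∪q B K (κ∈K i))
    ... | right j = contradiction x∈X (noloop j)

∣p∣≤0⇒p≡⊥ : ∀ {n} {p : Subset n} → ∣ p ∣ ≤ 0 → p ≡ ⊥
∣p∣≤0⇒p≡⊥ {p = p} p≤0 = Empty-unique λ (x , x∈p) → to (∣p∣≤0⇔Empty p) p≤0 x x∈p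

-- Sets of nullity `l` in `N` and in the uniform matroid.

module _ {n} {N : IndepFn n} (isN : IsMatroid N) (loopless : Loopless N) {r l} (n≡r+l : n ≡ r + l)
         (rank : HasRank N r) (avoid : ∀ e → ∃ λ Y → Indep N Y × ∣ Y ∣ ≡ r × e ∉ Y) where
  open IsMatroid isN

  n≤∣p∣⇒p≡⊤ : ∀ {p : Subset n} → r + l ≤ ∣ p ∣ → p ≡ ⊤
  n≤∣p∣⇒p≡⊤ {p} le = ∣p∣≡n⇒p≡⊤ (≤-antisym (∣p∣≤n p) (subst (_≤ ∣ p ∣) (sym n≡r+l) le))

  -- Suppose `x` is missed. A basis `Y` avoiding `x` extends `B` to a basis `Z` inside `B ∪ Y`. As
  -- `L` depends on `B`, it is disjoint from `Z`, so `Z ∪ L` has at least `r + l` points: it is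
  -- everything, yet misses `x`.
  nullity-l⇒⊤ : ∀ B L → Indep N B → ∣ B ∣ ≤ r → (∀ {x} → x ∈ L → ¬ Indep N (B ∪ ⁅ x ⁆)) →
    l ≤ ∣ L ∣ → ∀ x → x ∈ B ∪ L
  nullity-l⇒⊤ B L B-ind B≤r L-dep l≤L x with x ∈? B ∪ L
  ... | yes x∈ = x∈
  ... | no  x∉
    with Y , Y-ind , ∣Y∣≡r , x∉Y ← avoid x
    with Z , Z-ind , B⊆Z , Z⊆BY , ∣Z∣≡ ← augment-from isN (r ∸ ∣ B ∣) B Y B-ind Y-ind
           (trans ∣Y∣≡r (sym (m∸n+n≡m B≤r))) =
    contradiction (subst (x ∈_) (sym Z∪L≡⊤) ∈⊤) x∉Z∪L
    where
    Z-fresh : ∀ {y} → y ∈ Z → y ∉ L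
    Z-fresh y∈Z y∈L = L-dep y∈L (hereditary _ _ (p∪⁅x⁆⊆ B⊆Z y∈Z) Z-ind)

    Z∪L≡⊤ : Z ∪ L ≡ ⊤
    Z∪L≡⊤ = n≤∣p∣⇒p≡⊤ (subst (r + l ≤_)
      (sym (trans (∣p∪q∣≡∣p∣+∣q∣ Z L Z-fresh) (cong (_+ ∣ L ∣) (trans ∣Z∣≡ ∣Y∣≡r)))) (+-monoʳ-≤ r l≤L))

    x∉Z∪L : x ∉ Z ∪ L
    x∉Z∪L x∈ with x∈p∪q⁻ Z L x∈
    ... | inj₂ x∈L = x∉ (q⊆p∪q B L x∈L)
    ... | inj₁ x∈Z with x∈p∪q⁻ B Y (Z⊆BY x∈Z)
    ...   | inj₁ x∈B = x∉ (p⊆p∪q L x∈B)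
    ...   | inj₂ x∈Y = x∉Y x∈Y

  spanning⇒r≤∣B∣ : ∀ B L → Indep N B → (∀ {x} → x ∈ L → ¬ Indep N (B ∪ ⁅ x ⁆)) →
    (∀ x → x ∈ B ∪ L) → r ≤ ∣ B ∣
  spanning⇒r≤∣B∣ B L B-ind L-dep span = ≮⇒≥ λ B<r →
    let Y , (Y-ind , _) , ∣Y∣≡r = rank
        y , _ , y∉B , By-ind = augment B Y B-ind Y-ind (subst (∣ B ∣ <_) (sym ∣Y∣≡r) B<r) in
    [ y∉B , (λ y∈L → L-dep y∈L By-ind) ]′ (x∈p∪q⁻ B L (span y))

  -- Subscripts 1 and 2 refer to the side of `N` and the uniform side; `r ≤ ∣ B₂ ∣` is what
  -- dependence means on the latter. If `B₂` has size `r`, the bound on sizes empties `B₁`, and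
  -- looplessness empties `L₁`. Otherwise `L₂` is empty, so all the nullity lies in `N`; then
  -- `B₁ ∪ L₁` is everything, `B₁` has size `r`, and `B₂` is empty.
  classify : ∀ B₁ B₂ L₁ L₂ → Indep N B₁ → ∣ B₁ ∣ + ∣ B₂ ∣ ≤ r →
    (∀ {x} → x ∈ L₁ → x ∉ B₁ × ¬ Indep N (B₁ ∪ ⁅ x ⁆)) →
    (∀ {y} → y ∈ L₂ → y ∉ B₂ × r ≤ ∣ B₂ ∣) →
    l ≤ ∣ L₁ ∣ + ∣ L₂ ∣ →
    (B₁ ∪ L₁ ≡ ⊤ × B₂ ∪ L₂ ≡ ⊥ {n}) ⊎ (B₁ ∪ L₁ ≡ ⊥ × B₂ ∪ L₂ ≡ ⊤)
  classify B₁ B₂ L₁ L₂ B₁-ind B≤r L₁-dep L₂-dep l≤L with r ≤? ∣ B₂ ∣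
  ... | yes r≤B₂ = inj₂ (trans (cong₂ _∪_ B₁≡⊥ L₁≡⊥) (∪-identityˡ ⊥) , n≤∣p∣⇒p≡⊤ (subst (r + l ≤_)
      (sym (∣p∪q∣≡∣p∣+∣q∣ B₂ L₂ λ y∈B y∈L → proj₁ (L₂-dep y∈L) y∈B))
      (+-mono-≤ r≤B₂ (subst (λ c → l ≤ c + ∣ L₂ ∣) (trans (cong ∣_∣ L₁≡⊥) (∣⊥∣≡0 n)) l≤L))))
    where
    B₁≡⊥ : B₁ ≡ ⊥
    B₁≡⊥ = ∣p∣≤0⇒p≡⊥ (+-cancelʳ-≤ r ∣ B₁ ∣ 0 (≤-trans (+-monoʳ-≤ ∣ B₁ ∣ r≤B₂) B≤r))
    L₁≡⊥ : L₁ ≡ ⊥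
    L₁≡⊥ = Empty-unique λ (x , x∈L) → proj₂ (L₁-dep x∈L)
      (subst (Indep N) (sym (trans (cong (_∪ ⁅ x ⁆) B₁≡⊥) (∪-identityˡ ⁅ x ⁆))) (loopless x))
  ... | no r≰B₂ = inj₁
      ( ⊆-antisym ⊆⊤ (λ {x} _ → span x)
      , trans (cong₂ _∪_ (∣p∣≤0⇒p≡⊥ (+-cancelˡ-≤ r ∣ B₂ ∣ 0 B₂≤0)) L₂≡⊥) (∪-identityˡ ⊥))
    where
    L₂≡⊥ : L₂ ≡ ⊥
    L₂≡⊥ = Empty-unique λ (y , y∈L) → r≰B₂ (proj₂ (L₂-dep y∈L))
    l≤L₁ : l ≤ ∣ L₁ ∣
    l≤L₁ = subst (l ≤_) (trans (cong (λ L → ∣ L₁ ∣ + ∣ L ∣) L₂≡⊥)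
      (trans (cong (∣ L₁ ∣ +_) (∣⊥∣≡0 n)) (+-identityʳ _))) l≤L
    span : ∀ x → x ∈ B₁ ∪ L₁
    span = nullity-l⇒⊤ B₁ L₁ B₁-ind (≤-trans (m≤m+n _ _) B≤r) (proj₂ ∘ L₁-dep) l≤L₁
    B₂≤0 : r + ∣ B₂ ∣ ≤ r + 0
    B₂≤0 = ≤-trans (+-monoˡ-≤ ∣ B₂ ∣ (spanning⇒r≤∣B∣ B₁ L₁ B₁-ind (proj₂ ∘ L₁-dep) span))
      (≤-trans B≤r (≤-reflexive (sym (+-identityʳ r))))

  -- The matroid `M` of rank `r + k`, given by its independent sets.

  module _ (M : IndepFn (n + n)) {k} (1≤k : 1 ≤ k) (k≤r : k ≤ r) (1≤l : 1 ≤ l)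
           (M-indep : ∀ X Y → Indep M (X ++ Y) ⇔ (Indep N X × ∣ Y ∣ ≤ r × ∣ X ∣ + ∣ Y ∣ ≤ r + k)) where

    M-hereditary : Hereditary M
    M-hereditary {X} {Y} = ++-elim {n} (λ X → ∀ Y → Y ⊆ X → Indep M X → Indep M Y)
      (λ X₁ X₂ → ++-elim {n} (λ Y → Y ⊆ X₁ ++ X₂ → Indep M (X₁ ++ X₂) → Indep M Y) (go X₁ X₂)) X Y
      where
      go : ∀ X₁ X₂ Y₁ Y₂ → Y₁ ++ Y₂ ⊆ X₁ ++ X₂ → Indep M (X₁ ++ X₂) → Indep M (Y₁ ++ Y₂)
      go X₁ X₂ Y₁ Y₂ Y⊆X X-ind with X₁-ind , X₂≤r , X≤ ← to (M-indep X₁ X₂) X-ind =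
        from (M-indep Y₁ Y₂) ( hereditary X₁ Y₁ Y₁⊆X₁ X₁-ind
                             , ≤-trans (p⊆q⇒∣p∣≤∣q∣ Y₂⊆X₂) X₂≤r
                             , ≤-trans (+-mono-≤ (p⊆q⇒∣p∣≤∣q∣ Y₁⊆X₁) (p⊆q⇒∣p∣≤∣q∣ Y₂⊆X₂)) X≤)
        where
        Y₁⊆X₁ : Y₁ ⊆ X₁
        Y₁⊆X₁ = ∈-++⁻ˡ X₂ ∘ Y⊆X ∘ ∈-++⁺ˡ Y₂
        Y₂⊆X₂ : Y₂ ⊆ X₂
        Y₂⊆X₂ = ∈-++⁻ʳ X₁ ∘ Y⊆X ∘ ∈-++⁺ʳ Y₁

    ∣M-indep∣≤r+k : ∀ X → Indep M X → ∣ X ∣ ≤ r + k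
    ∣M-indep∣≤r+k = ++-elim {n} (λ X → Indep M X → ∣ X ∣ ≤ r + k) λ X Y ind →
      subst (_≤ r + k) (sym (∣p++q∣≡∣p∣+∣q∣ X Y)) (proj₂ (proj₂ (to (M-indep X Y) ind)))

    isLeft : Fin (n + n) → Bool
    isLeft x = [ const true , const false ]′ (splitAt n x)

    isLeft-↑ˡ : ∀ i → isLeft (i ↑ˡ n) ≡ true
    isLeft-↑ˡ i = cong [ const true , const false ]′ (splitAt-↑ˡ n i n)

    isLeft-↑ʳ : ∀ j → isLeft (n ↑ʳ j) ≡ false
    isLeft-↑ʳ j = cong [ const true , const false ]′ (splitAt-↑ʳ n n j)

    -- `true` stands for the ground set of `N`, `false` for that of the uniform matroid. In this
    -- form a single point, inside `S` or outside it, determines `s`.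
    IsSide : Subset (n + n) → Bool → Set
    IsSide S s = ∀ x → x ∈ S ⇔ isLeft x ≡ s

    left-side : IsSide (⊤ {n} ++ ⊥ {n}) true
    left-side x with sides n {n} x
    ... | left  i = mk⇔ (λ _ → isLeft-↑ˡ i) (λ _ → ∈-++⁺ˡ ⊥ ∈⊤)
    ... | right j = mk⇔ (λ x∈ → contradiction (∈-++⁻ʳ (⊤ {n}) x∈) ∉⊥)
                        (λ eq → contradiction (trans (sym eq) (isLeft-↑ʳ j)) λ ())

    right-side : IsSide (⊥ {n} ++ ⊤ {n}) false
    right-side x with sides n {n} x
    ... | left  i = mk⇔ (λ x∈ → contradiction (∈-++⁻ˡ (⊤ {n}) x∈) ∉⊥)
                        (λ eq → contradiction (trans (sym eq) (isLeft-↑ˡ i)) λ ())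
    ... | right j = mk⇔ (λ _ → isLeft-↑ʳ j) (λ _ → ∈-++⁺ʳ (⊥ {n}) ∈⊤)

    -- Stated for any `L` of at least `l` points dependent on `B`, so that it also applies after a
    -- further dependent point has been added.
    flat-isSide : ∀ B L → Indep M B → ∣ B ∣ ≤ r → (∀ {x} → x ∈ L → x ∉ B × ¬ Indep M (B ∪ ⁅ x ⁆)) →
      l ≤ ∣ L ∣ → ∃ (IsSide (B ∪ L))
    flat-isSide = ++-elim {n}
      (λ B → ∀ L → Indep M B → ∣ B ∣ ≤ r → (∀ {x} → x ∈ L → x ∉ B × ¬ Indep M (B ∪ ⁅ x ⁆)) →
        l ≤ ∣ L ∣ → ∃ (IsSide (B ∪ L)))
      λ B₁ B₂ → ++-elim {n} (λ L → Indep M (B₁ ++ B₂) → ∣ B₁ ++ B₂ ∣ ≤ r →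
          (∀ {x} → x ∈ L → x ∉ B₁ ++ B₂ × ¬ Indep M ((B₁ ++ B₂) ∪ ⁅ x ⁆)) →
          l ≤ ∣ L ∣ → ∃ (IsSide ((B₁ ++ B₂) ∪ L)))
        (go B₁ B₂)
      where
      go : ∀ B₁ B₂ L₁ L₂ → Indep M (B₁ ++ B₂) → ∣ B₁ ++ B₂ ∣ ≤ r →
        (∀ {x} → x ∈ L₁ ++ L₂ → x ∉ B₁ ++ B₂ × ¬ Indep M ((B₁ ++ B₂) ∪ ⁅ x ⁆)) →
        l ≤ ∣ L₁ ++ L₂ ∣ → ∃ (IsSide ((B₁ ++ B₂) ∪ (L₁ ++ L₂)))
      go B₁ B₂ L₁ L₂ B-ind B≤r L-dep l≤L
        with B₁-ind , B₂≤r , _ ← to (M-indep B₁ B₂) B-ind =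
        [ (λ (eq₁ , eq₂) → true  , subst (λ S → IsSide S true)  (sym (S≡ eq₁ eq₂)) left-side)
        , (λ (eq₁ , eq₂) → false , subst (λ S → IsSide S false) (sym (S≡ eq₁ eq₂)) right-side) ]′
        (classify B₁ B₂ L₁ L₂ B₁-ind B≤r′ L₁-dep L₂-dep (subst (l ≤_) (∣p++q∣≡∣p∣+∣q∣ L₁ L₂) l≤L))
        where
        S≡ : ∀ {S₁ S₂} → B₁ ∪ L₁ ≡ S₁ → B₂ ∪ L₂ ≡ S₂ → (B₁ ++ B₂) ∪ (L₁ ++ L₂) ≡ S₁ ++ S₂
        S≡ eq₁ eq₂ = trans (∪-++ B₁ L₁ B₂ L₂) (cong₂ _++_ eq₁ eq₂)

        B≤r′ : ∣ B₁ ∣ + ∣ B₂ ∣ ≤ r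
        B≤r′ = subst (_≤ r) (∣p++q∣≡∣p∣+∣q∣ B₁ B₂) B≤r

        -- One more point still fits under the rank `r + k`, because `1 ≤ k`. Hence dependence over
        -- `B` comes from one of the two summands and never from the truncation.
        1+B≤r+k : suc (∣ B₁ ∣ + ∣ B₂ ∣) ≤ r + k
        1+B≤r+k = ≤-trans (≤-reflexive (+-comm 1 _)) (+-mono-≤ B≤r′ 1≤k)

        L₁-dep : ∀ {x} → x ∈ L₁ → x ∉ B₁ × ¬ Indep N (B₁ ∪ ⁅ x ⁆)
        L₁-dep {x} x∈L₁ with x∉B , dep ← L-dep (∈-++⁺ˡ L₂ x∈L₁) = x∉B₁ , λ B₁x-ind →
          dep (subst (Indep M)
            (sym (trans (cong ((B₁ ++ B₂) ∪_) (⁅i↑ˡ⁆ n x)) (trans (∪-++ B₁ _ B₂ _) (cong (_ ++_) (∪-identityʳ B₂)))))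
            (from (M-indep _ _)
              ( B₁x-ind , B₂≤r
              , subst (λ c → c + ∣ B₂ ∣ ≤ r + k) (sym (x∉p⇒∣p∪⁅x⁆∣≡1+∣p∣ B₁ x x∉B₁)) 1+B≤r+k)))
          where
          x∉B₁ : x ∉ B₁
          x∉B₁ = x∉B ∘ ∈-++⁺ˡ B₂

        L₂-dep : ∀ {y} → y ∈ L₂ → y ∉ B₂ × r ≤ ∣ B₂ ∣
        L₂-dep {y} y∈L₂ with y∉B , dep ← L-dep (∈-++⁺ʳ L₁ y∈L₂) = y∉B₂ , ≮⇒≥ λ B₂<r →
          dep (subst (Indep M)
            (sym (trans (cong ((B₁ ++ B₂) ∪_) (⁅↑ʳj⁆ n y)) (trans (∪-++ B₁ _ B₂ _) (cong (_++ _) (∪-identityʳ B₁)))))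
            (from (M-indep _ _)
              ( B₁-ind , subst (_≤ r) (sym ∣B₂y∣) B₂<r
              , subst (λ c → ∣ B₁ ∣ + c ≤ r + k) (sym ∣B₂y∣)
                  (subst (_≤ r + k) (sym (+-suc ∣ B₁ ∣ ∣ B₂ ∣)) 1+B≤r+k))))
          where
          y∉B₂ : y ∉ B₂
          y∉B₂ = y∉B ∘ ∈-++⁺ʳ B₁
          ∣B₂y∣ : ∣ B₂ ∪ ⁅ y ⁆ ∣ ≡ suc ∣ B₂ ∣
          ∣B₂y∣ = x∉p⇒∣p∪⁅x⁆∣≡1+∣p∣ B₂ y y∉B₂

    module _ {h : Fin (k + l) → Fin (n + n)} {B} (E : Embeds M (U k k ⊕ U 0 l) h B) where

      private
        ∣L∣≡l : ∣ loops k l E ∣ ≡ l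
        ∣L∣≡l = ∣loops∣ k l E

        B-ind : Indep M B
        B-ind = let I , I-ind , B⊆I , _ = coloops-indep k l E in M-hereditary B⊆I I-ind

        -- The free summand yields an independent set of size `k + ∣ B ∣`, and the rank is `r + k`.
        B≤r : ∣ B ∣ ≤ r
        B≤r = let I , I-ind , _ , ∣I∣≡ = coloops-indep k l E in
          +-cancelˡ-≤ k _ _ (subst (k + ∣ B ∣ ≤_) (+-comm r k) (subst (_≤ r + k) ∣I∣≡ (∣M-indep∣≤r+k I I-ind)))

      embedded-isSide : ∃ (IsSide (B ∪ loops k l E))
      embedded-isSide = flat-isSide B (loops k l E) B-ind B≤r
        (λ x∈ → loops-fresh k l E x∈ , loops-dep k l E x∈) (≤-reflexive (sym ∣L∣≡l))

      -- If `v` depended on `B` but lay outside, adding it to the loops would give a second side.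
      -- Both sides contain a loop, which exists by `1 ≤ l`, so they coincide and `v` was inside
      -- already.
      embedded-closed : ∀ {v} → ¬ Indep M (B ∪ ⁅ v ⁆) → ¬ (v ∉ B ∪ loops k l E)
      embedded-closed {v} v-dep v∉S =
        let s , side = embedded-isSide
            s′ , side′ = flat-isSide B (L ∪ ⁅ v ⁆) B-ind B≤r L-dep
                         (≤-trans (≤-reflexive (sym ∣L∣≡l)) (∣p∣≤∣p∪q∣ L ⁅ v ⁆))
            x , x∈L = 0<∣p∣⇒Nonempty L (subst (1 ≤_) (sym ∣L∣≡l) 1≤l)
            s≡s′ = trans (sym (to (side x) (q⊆p∪q B _ x∈L)))
                         (to (side′ x) (q⊆p∪q B _ (p⊆p∪q ⁅ v ⁆ x∈L)))
        in v∉S (from (side v) (trans (to (side′ v) (q⊆p∪q B _ (x∈p∪⁅x⁆ L v))) (sym s≡s′)))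
        where
        L = loops k l E
        L-dep : ∀ {x} → x ∈ L ∪ ⁅ v ⁆ → x ∉ B × ¬ Indep M (B ∪ ⁅ x ⁆)
        L-dep x∈ with x∈p∪q⁻ L ⁅ v ⁆ x∈
        ... | inj₁ x∈L = loops-fresh k l E x∈L , loops-dep k l E x∈L
        ... | inj₂ x∈v with refl ← x∈⁅y⁆⇒x≡y v x∈v = v∉S ∘ p⊆p∪q L , v-dep

    -- Proper minors of `M`.

    module _ {n′} {M′ : IndepFn (suc n′)} {f B} (E : Embeds M M′ f B) (v : Fin (suc n′)) where

      -- A side compatible with the minor `M′`: it contains the contracted points `B` and none of
      -- the points outside `B ∪ image f ⊤`, which are deleted.
      record SideOver (s : Bool) : Set where
        field
          side   : Subset (n + n)
          isSide : IsSide side s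
          above  : B ⊆ side
          below  : side ⊆ B ∪ image f ⊤

      open SideOver

      f∈ : ∀ i → f i ∈ B ∪ image f ⊤
      f∈ i = q⊆p∪q B (image f ⊤) (∈-image⁺ f ⊤ ∈⊤)

      punched⊆ : ∀ {c} (g : Fin c → Fin n′) X → image (f ∘ punchIn v ∘ g) X ⊆ B ∪ image f ⊤
      punched⊆ g X = image-⊆ _ X λ {i} _ → f∈ (punchIn v (g i))

      -- With `B` empty, a point outside the image of `f` has been deleted, and a compatible side
      -- cannot contain it.
      missed : ¬ Nonempty B → ∀ {w} → (∀ i → f i ≢ w) → ∀ {s} → SideOver s → isLeft w ≢ s
      missed B-empty {w} w∉f S w≡s with x∈p∪q⁻ B (image f ⊤) (below S (from (isSide S w) w≡s))
      ... | inj₁ w∈B = B-empty (w , w∈B)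
      ... | inj₂ w∈f with i , _ , eq ← ∈-image⁻ f ⊤ w∈f = w∉f i eq

      -- The forbidden minor embeds in `M` through `f ∘ punchIn v`, so its side is built from `B`
      -- and points of the image other than `f v`.
      del-side : HasMinor (M′ del v) (U k k ⊕ U 0 l) →
        Indep M′ ⁅ v ⁆ × ∃ λ s → SideOver s × isLeft (f v) ≢ s
      del-side minor with g , C , Eᵍ ← hasMinor⇒embeds minor =
        v-ind , s , record
          { side   = S
          ; isSide = S-isSide
          ; above  = p⊆p∪q L ∘ B⊆Bˢ
          ; below  = ∪-lub (∪-lub (punched⊆ (λ i → i) C) (p⊆p∪q (image f ⊤))) (punched⊆ (g ∘ (k ↑ʳ_)) ⊤)
          } , fv∉S ∘ from (S-isSide (f v))
        where
        Bˢ = image (f ∘ punchIn v) C ∪ B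
        Eˢ = embeds-trans (embeds-del E v) Eᵍ
        L = loops k l Eˢ
        S = Bˢ ∪ L
        s = proj₁ (embedded-isSide Eˢ)
        S-isSide = proj₂ (embedded-isSide Eˢ)
        B⊆Bˢ : B ⊆ Bˢ
        B⊆Bˢ = q⊆p∪q (image (f ∘ punchIn v) C) B
        fv∉punched : ∀ {c} (g : Fin c → Fin n′) X → f v ∉ image (f ∘ punchIn v ∘ g) X
        fv∉punched g X fv∈ with i , _ , eq ← ∈-image⁻ _ X fv∈ = punchInᵢ≢i v (g i) (injective E eq)
        fv∉S : f v ∉ S
        fv∉S fv∈ with x∈p∪q⁻ Bˢ L fv∈
        ... | inj₂ fv∈L = fv∉punched (g ∘ (k ↑ʳ_)) ⊤ fv∈L
        ... | inj₁ fv∈Bˢ = [ fv∉punched (λ i → i) C , disjoint E v ]′ (x∈p∪q⁻ _ B fv∈Bˢ)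
        v-ind : Indep M′ ⁅ v ⁆
        v-ind with T? (M′ ⁅ v ⁆)
        ... | yes v-ind = v-ind
        -- A loop `v` of `M′` would make `f v` dependent on `B`, hence on the larger `Bˢ`, and
        -- `embedded-closed` would place `f v` in the side.
        ... | no  v-dep = contradiction fv∉S (embedded-closed Eˢ λ ind → v-dep (subst T (sym (indep E ⁅ v ⁆))
          (M-hereditary (∪-lub (subst (_⊆ Bˢ ∪ ⁅ f v ⁆) (sym (image-⁅⁆ f v)) (q⊆p∪q Bˢ ⁅ f v ⁆))
                               (p⊆p∪q ⁅ f v ⁆ ∘ B⊆Bˢ)) ind)))

      -- Contracting the nonloop `v` puts `f v` among the contracted points, which every compatible
      -- side contains.
      con-side : Indep M′ ⁅ v ⁆ → HasMinor (M′ con v) (U k k ⊕ U 0 l) →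
        ∃ λ s → SideOver s × isLeft (f v) ≡ s
      con-side v-ind minor with g , C , Eᵍ ← hasMinor⇒embeds minor =
        s , record
          { side   = Bˢ ∪ L
          ; isSide = S-isSide
          ; above  = p⊆p∪q L ∘ Bᵛ⊆Bˢ ∘ q⊆p∪q ⁅ f v ⁆ B
          ; below  = ∪-lub (∪-lub (punched⊆ (λ i → i) C)
                                  (∪-lub (x∈p⇒⁅x⁆⊆p (f∈ v)) (p⊆p∪q (image f ⊤))))
                           (punched⊆ (g ∘ (k ↑ʳ_)) ⊤)
          } , to (S-isSide (f v)) (p⊆p∪q L (Bᵛ⊆Bˢ (p⊆p∪q B (x∈⁅x⁆ (f v)))))
        where
        Bˢ = image (f ∘ punchIn v) C ∪ (⁅ f v ⁆ ∪ B)
        Eˢ = embeds-trans (embeds-con E v v-ind) Eᵍ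
        L = loops k l Eˢ
        s = proj₁ (embedded-isSide Eˢ)
        S-isSide = proj₂ (embedded-isSide Eˢ)
        Bᵛ⊆Bˢ : ⁅ f v ⁆ ∪ B ⊆ Bˢ
        Bᵛ⊆Bˢ = q⊆p∪q (image (f ∘ punchIn v) C) (⁅ f v ⁆ ∪ B)

      -- Any point of B, or any point outside im f when B is empty, determines which side a SideOver is;
      -- as the side from deletion avoids f v and the one from contraction contains it, only one can occur.
      uniform-side : suc n′ < n + n → KLUniform k l (M′ del v) ⊎ KLUniform k l (M′ con v)
      uniform-side lt with T? (M′ ⁅ v ⁆) | nonempty? B
      ... | no v-dep  | _ = inj₁ (v-dep ∘ proj₁ ∘ del-side)
      ... | yes v-ind | yes (b , b∈B) with isLeft b ≟ᵇ isLeft (f v)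
      ...   | yes b≡v = inj₁ λ minor → let _ , s , S , v≢s = del-side minor in
                v≢s (trans (sym b≡v) (to (isSide S b) (above S b∈B)))
      ...   | no  b≢v = inj₂ λ minor → let s , S , v≡s = con-side v-ind minor in
                b≢v (trans (to (isSide S b) (above S b∈B)) (sym v≡s))
      uniform-side lt | yes v-ind | no B-empty with w , w∉f ← missed-point f lt
        with isLeft w ≟ᵇ isLeft (f v)
      ... | yes w≡v = inj₂ λ minor → let s , S , v≡s = con-side v-ind minor in
              missed B-empty w∉f S (trans w≡v v≡s)
      ... | no  w≢v = inj₁ λ minor → let _ , s , S , v≢s = del-side minor in
              missed B-empty w∉f S (trans (¬-not w≢v) (sym (¬-not (v≢s ∘ sym))))

    proper-minors : ∀ {n′} (M′ : IndepFn n′) → ProperMinor M M′ → AlmostKLUniform k l M′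
    proper-minors {zero}   M′ _            = tt
    proper-minors {suc n′} M′ (lt , minor) v =
      let f , B , E = hasMinor⇒embeds minor in uniform-side E v lt

    -- Absence of loops and coloops in `M`.

    M-loopless : Loopless M
    M-loopless e with sides n {n} e
    ... | left  i = subst (Indep M) (sym (⁅i↑ˡ⁆ n i)) (from (M-indep _ _) (loopless i ,
          ≤-trans (≤-reflexive (∣⊥∣≡0 n)) z≤n ,
          ≤-trans (≤-reflexive (cong₂ _+_ (∣⁅x⁆∣≡1 i) (∣⊥∣≡0 n))) (≤-trans 1≤k (m≤n+m k r))))
    ... | right j = subst (Indep M) (sym (⁅↑ʳj⁆ n j)) (from (M-indep _ _) (empty-indep ,
          ≤-trans (≤-reflexive (∣⁅x⁆∣≡1 j)) 1≤r ,
          ≤-trans (≤-reflexive (cong₂ _+_ (∣⊥∣≡0 n) (∣⁅x⁆∣≡1 j))) (≤-trans 1≤k (m≤n+m k r))))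
      where
      1≤r : 1 ≤ r
      1≤r = ≤-trans 1≤k k≤r

    ++-isBase : ∀ X Y → Indep N X → ∣ X ∣ ≡ r → ∣ Y ∣ ≡ k → IsBase M (X ++ Y)
    ++-isBase X Y X-ind ∣X∣≡r ∣Y∣≡k =
      from (M-indep X Y) (X-ind , subst (_≤ r) (sym ∣Y∣≡k) k≤r , ≤-reflexive (cong₂ _+_ ∣X∣≡r ∣Y∣≡k)) ,
      λ y y∉ ind → <-irrefl refl (subst (_≤ r + k)
        (trans (x∉p⇒∣p∪⁅x⁆∣≡1+∣p∣ (X ++ Y) y y∉)
               (cong suc (trans (∣p++q∣≡∣p∣+∣q∣ X Y) (cong₂ _+_ ∣X∣≡r ∣Y∣≡k))))
        (∣M-indep∣≤r+k _ ind))

    k<n : k < n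
    k<n = ≤-trans (≤-reflexive (+-comm 1 k)) (≤-trans (+-mono-≤ k≤r 1≤l) (≤-reflexive (sym n≡r+l)))

    -- A basis of `N` together with any `k` points of the uniform side is a base. On the left, take
    -- a basis of `N` avoiding `e`; on the right, choose the `k` points off `e`, which `k < n`
    -- allows.
    M-coloopless : Coloopless M
    M-coloopless e with sides n {n} e
    ... | left  i =
      let X , X-ind , ∣X∣≡r , i∉X = avoid i
          Y , _ , ∣Y∣≡k = subset-of-size ⊤ k (subst (k ≤_) (sym (∣⊤∣≡n n)) (<⇒≤ k<n))
      in X ++ Y , ++-isBase X Y X-ind ∣X∣≡r ∣Y∣≡k , i∉X ∘ ∈-++⁻ˡ Y
    ... | right j =
      let X , (X-ind , _) , ∣X∣≡r = rank
          Y , Y⊆ , ∣Y∣≡k = subset-of-size (∁ ⁅ j ⁆) k (subst (k ≤_)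
            (sym (trans (∣∁p∣≡n∸∣p∣ ⁅ j ⁆) (cong (n ∸_) (∣⁅x⁆∣≡1 j)))) (∸-monoˡ-≤ 1 k<n))
      in X ++ Y , ++-isBase X Y X-ind ∣X∣≡r ∣Y∣≡k , λ j∈ → x∈∁p⇒x∉p (Y⊆ (∈-++⁻ʳ X j∈)) (x∈⁅x⁆ j)

-- Forbidden minors of `M` after deleting or contracting one element.

module _ {n} {N : IndepFn (suc n)} (isN : IsMatroid N) {k r l} (1+n≡r+l : suc n ≡ r + l) (k≤r : k ≤ r)
         (rank : HasRank N r) (nonloop : Indep N ⁅ zero ⁆)
         (avoid : ∃ λ Y → Indep N Y × ∣ Y ∣ ≡ r × zero ∉ Y)
         (M : IndepFn (suc n + suc n)) (her : Hereditary M) (M-nonloop : Indep M ⁅ zero ⁆)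
         (M-indep : ∀ X Y → Indep M (X ++ Y) ⇔ (Indep N X × ∣ Y ∣ ≤ r × ∣ X ∣ + ∣ Y ∣ ≤ r + k)) where
  open IsMatroid isN

  private
    ∪-++ˡ⊥ : (p : Subset n) (q q′ : Subset (suc n)) → (p ++ q) ∪ (⊥ ++ q′) ≡ p ++ (q ∪ q′)
    ∪-++ˡ⊥ p q q′ = trans (∪-++ p ⊥ q q′) (cong (_++ (q ∪ q′)) (∪-identityʳ p))

    ∪-++ʳ⊥ : (p p′ : Subset n) (q : Subset (suc n)) → (p ++ q) ∪ (p′ ++ ⊥) ≡ (p ∪ p′) ++ q
    ∪-++ʳ⊥ p p′ q = trans (∪-++ p p′ q ⊥) (cong ((p ∪ p′) ++_) (∪-identityʳ q))

    left-right-disjoint : ∀ {p : Subset n} {q : Subset (suc n)} {x} → x ∈ p ++ ⊥ → x ∉ ⊥ ++ q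
    left-right-disjoint {p} {q} {x} x∈ˡ x∈ʳ with sides n {suc n} x
    ... | left  i = ∉⊥ (∈-++⁻ˡ q x∈ʳ)
    ... | right j = ∉⊥ (∈-++⁻ʳ p x∈ˡ)

    ∣p++⊥∣ : (p : Subset n) → ∣ p ++ ⊥ {suc n} ∣ ≡ ∣ p ∣
    ∣p++⊥∣ p = trans (∣p++q∣≡∣p∣+∣q∣ p (⊥ {suc n})) (trans (cong (∣ p ∣ +_) (∣⊥∣≡0 (suc n))) (+-identityʳ _))

    ∣⊥++q∣ : (q : Subset (suc n)) → ∣ ⊥ {n} ++ q ∣ ≡ ∣ q ∣
    ∣⊥++q∣ q = trans (∣p++q∣≡∣p∣+∣q∣ (⊥ {n}) q) (cong (_+ ∣ q ∣) (∣⊥∣≡0 n))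

    r+l∸r : suc n ∸ r ≡ l
    r+l∸r = trans (cong (_∸ r) 1+n≡r+l) (m+n∸m≡n r l)

    ⊤-subset : ∀ c → c ≤ r → ∃ λ (T : Subset (suc n)) → ∣ T ∣ ≡ c
    ⊤-subset c c≤r = let T , _ , ∣T∣≡c = subset-of-size (⊤ {suc n}) c (subst (c ≤_) (sym (∣⊤∣≡n (suc n)))
                                            (≤-trans c≤r (subst (r ≤_) (sym 1+n≡r+l) (m≤m+n r l))))
                     in T , ∣T∣≡c

    tail-of : (∃ λ Y → Indep N Y × ∣ Y ∣ ≡ r × zero ∉ Y) → ∃ λ Y → Indep N (false ∷ Y) × ∣ Y ∣ ≡ r
    tail-of (true  ∷ Y , _ , _ , 0∉Y)         = contradiction here 0∉Y
    tail-of (false ∷ Y , Y-ind , ∣Y∣≡r , _) = Y , Y-ind , ∣Y∣≡r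

  -- The uniform side survives: contracting `r` of its points `W` turns the other `l` into loops,
  -- and `k` points of a basis of `N` avoiding `zero` remain independent. Since `zero` heads the
  -- left block, deletion leaves the ground set `n + suc n` by computation.
  del-minor : HasMinor (M del zero) (U k k ⊕ U 0 l)
  del-minor
    with Y , Y-ind , ∣Y∣≡r ← tail-of avoid
    with K , K⊆Y , ∣K∣≡k ← subset-of-size Y k (subst (k ≤_) (sym ∣Y∣≡r) k≤r)
    with W , ∣W∣≡r ← ⊤-subset r ≤-refl =
    hasMinor-Uₖₖ⊕U₀ₗ (her ∘ s⊆s) (⊥ ++ W) (K ++ ⊥) (⊥ ++ ∁ W)
      (subst (Indep (M del zero)) (sym (trans (∪-++ʳ⊥ ⊥ K W) (cong (_++ W) (∪-identityˡ K))))
        (from (M-indep (false ∷ K) W) ( hereditary _ _ (s⊆s K⊆Y) Y-ind , ≤-reflexive ∣W∣≡r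
                                      , ≤-reflexive (trans (cong₂ _+_ ∣K∣≡k ∣W∣≡r) (+-comm k r)))))
      left-right-disjoint
      (λ {x} → dep x)
      (≤-reflexive (sym (trans (∣p++⊥∣ K) ∣K∣≡k)))
      (≤-reflexive (sym (trans (∣⊥++q∣ (∁ W)) (trans (∣∁p∣≡n∸∣p∣ W) (trans (cong (suc n ∸_) ∣W∣≡r) r+l∸r)))))
    where
    dep : ∀ x → x ∈ ⊥ {n} ++ ∁ W → ¬ Indep (M del zero) ((⊥ ++ W) ∪ ⁅ x ⁆)
    dep x x∈ ind with sides n {suc n} x
    ... | left  i = ∉⊥ (∈-++⁻ˡ (∁ W) x∈)
    ... | right j = <⇒≱ (≤-reflexive (trans (cong suc (sym ∣W∣≡r)) (sym (x∉p⇒∣p∪⁅x⁆∣≡1+∣p∣ W j j∉W))))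
        (proj₁ (proj₂ (to (M-indep (false ∷ ⊥) _)
          (subst (Indep (M del zero)) (trans (cong ((⊥ ++ W) ∪_) (⁅↑ʳj⁆ n j)) (∪-++ˡ⊥ ⊥ W ⁅ j ⁆)) ind))))
      where
      j∉W : j ∉ W
      j∉W = x∈∁p⇒x∉p (∈-++⁻ʳ (⊥ {n}) x∈)

  -- The mirror image: `true ∷ Y` is a basis of `N` through `zero`, so contracting `zero` and then
  -- `Y` makes the rest of the left side loops, while any `k` points of the uniform side stay
  -- independent.
  con-minor : HasMinor (M con zero) (U k k ⊕ U 0 l)
  con-minor with base-contains isN {zero} rank nonloop
  ... | true ∷ Y , Y-ind , 1+∣Y∣≡r , here with W , ∣W∣≡k ← ⊤-subset k k≤r =
    hasMinor-Uₖₖ⊕U₀ₗ (λ {X} {Z} Z⊆X → Ind⁻ Z ∘ her (s⊆s Z⊆X) ∘ Ind⁺ X) (Y ++ ⊥) (⊥ ++ W) (∁ Y ++ ⊥)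
      (subst (Indep (M con zero)) (sym (trans (∪-++ˡ⊥ Y ⊥ W) (cong (Y ++_) (∪-identityˡ W))))
        (Ind⁻ (Y ++ W) (from (M-indep (true ∷ Y) W)
          (Y-ind , subst (_≤ r) (sym ∣W∣≡k) k≤r , ≤-reflexive (cong₂ _+_ 1+∣Y∣≡r ∣W∣≡k)))))
      (λ x∈ʳ x∈ˡ → left-right-disjoint x∈ˡ x∈ʳ)
      (λ {x} → dep x)
      (≤-reflexive (sym (trans (∣⊥++q∣ W) ∣W∣≡k)))
      -- `zero` is missing from both the remaining left block and `Y`, so `n ∸ ∣ Y ∣` is `suc n ∸ r`
      -- by computation, which is `l`.
      (≤-reflexive (sym (trans (∣p++⊥∣ (∁ Y)) (trans (∣∁p∣≡n∸∣p∣ Y) (trans (cong (suc n ∸_) 1+∣Y∣≡r) r+l∸r)))))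
    where
    Ind⁺ : ∀ X → Indep (M con zero) X → Indep M (true ∷ X)
    Ind⁺ X = subst T (con-nonloop M zero M-nonloop X)

    Ind⁻ : ∀ X → Indep M (true ∷ X) → Indep (M con zero) X
    Ind⁻ X = subst T (sym (con-nonloop M zero M-nonloop X))

    dep : ∀ x → x ∈ ∁ Y ++ ⊥ {suc n} → ¬ Indep (M con zero) ((Y ++ ⊥) ∪ ⁅ x ⁆)
    dep x x∈ ind with sides n {suc n} x
    ... | right j = ∉⊥ (∈-++⁻ʳ (∁ Y) x∈)
    ... | left  i = <⇒≱ (≤-reflexive (trans (cong suc (sym 1+∣Y∣≡r)) (cong suc (sym (x∉p⇒∣p∪⁅x⁆∣≡1+∣p∣ Y i i∉Y)))))
        (subst (∣ true ∷ (Y ∪ ⁅ i ⁆) ∣ ≤_) (proj₂ (proj₂ rank)) (∣indep∣≤∣base∣ isN (proj₁ (proj₂ rank))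
          (proj₁ (to (M-indep (true ∷ (Y ∪ ⁅ i ⁆)) ⊥) (Ind⁺ ((Y ∪ ⁅ i ⁆) ++ ⊥)
            (subst (Indep (M con zero)) (trans (cong ((Y ++ ⊥) ∪_) (⁅i↑ˡ⁆ (suc n) i)) (∪-++ʳ⊥ Y ⁅ i ⁆ ⊥)) ind))))))
      where
      i∉Y : i ∉ Y
      i∉Y = x∈∁p⇒x∉p (∈-++⁻ˡ (⊥ {suc n}) x∈)

  not-almost-uniform : ¬ AlmostKLUniform k l M
  not-almost-uniform almost = [ (λ uniform → uniform del-minor) , (λ uniform → uniform con-minor) ]′ (almost zero)

theorem1p4 : (k l m : ℕ) → 1 ≤ k → 1 ≤ l →
    (N : IndepFn (k + l + m)) → IsMatroid N → Loopless N → Coloopless N →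
    HasRank N (k + m) →
    let M = τ^ m (N ⊕ U (k + m) (k + l + m)) in
    Loopless M × Coloopless M × ExcludedMinorAlmostKLUniform k l M
-- Exposing `k` as a successor makes the ground set visibly nonempty: `AlmostKLUniform` unfolds, and
-- `zero` is an element of `N`.
theorem1p4 k@(suc _) l m 1≤k 1≤l N isN loopless coloopless rank@(_ , B-base , ∣B∣≡r) =
  M-loopless isN loopless n≡r+l rank avoid M 1≤k k≤r 1≤l M-indep ,
  M-coloopless isN loopless n≡r+l rank avoid M 1≤k k≤r 1≤l M-indep ,
  not-almost-uniform isN n≡r+l k≤r rank (loopless zero) (avoid zero) M
    (M-hereditary isN loopless n≡r+l rank avoid M 1≤k k≤r 1≤l M-indep)
    (M-loopless isN loopless n≡r+l rank avoid M 1≤k k≤r 1≤l M-indep zero) M-indep ,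
  proper-minors isN loopless n≡r+l rank avoid M 1≤k k≤r 1≤l M-indep
  where
  r = k + m
  M = τ^ m (N ⊕ U r (k + l + m))
  k≤r : k ≤ r
  k≤r = m≤m+n k m

  n≡r+l : k + l + m ≡ r + l
  n≡r+l = trans (+-assoc k l m) (trans (cong (k +_) (+-comm l m)) (sym (+-assoc k m l)))

  -- Coloop-freeness gives a base missing `e`; its size is `r` because all bases of `N` are
  -- equicardinal.
  avoid : ∀ e → ∃ λ Y → Indep N Y × ∣ Y ∣ ≡ r × e ∉ Y
  avoid e = let Y , Y-base , e∉Y = coloopless e in
    Y , proj₁ Y-base ,
    trans (≤-antisym (∣indep∣≤∣base∣ isN B-base (proj₁ Y-base)) (∣indep∣≤∣base∣ isN Y-base (proj₁ B-base))) ∣B∣≡r ,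
    e∉Y

  M-indep : ∀ X Y → Indep M (X ++ Y) ⇔ (Indep N X × ∣ Y ∣ ≤ r × ∣ X ∣ + ∣ Y ∣ ≤ r + k)
  M-indep = τ^-⊕U-indep isN rank (subst (r ≤_) (sym n≡r+l) (m≤m+n r l)) k m refl
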